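{- Let $(a_k)_{k\ge1}$ be a sequence of positive integers. If there exists an integer $m\ge0$ such that the infinite word $a_{m+1}a_{m+2}\ldots$ is recurrent, then, for every sequence $\mathcal{D}$ of integers greater than or equal to $2$, the real number $\alpha:=[0;a_1,a_2,\ldots]$ satisfies $$\inf_{q\ge1}\; q\cdot\Vert q\alpha\Vert\cdot|q|_{\mathcal{D}}=0,$$ where the infimum is over positive integers $q$.
   Context: $\Vert x\Vert$ denotes the distance from the real number $x$ to the nearest integer. $[0;a_1,a_2,\ldots]$ denotes the continued fraction with partial quotients $a_1,a_2,\ldots$. An infinite word is recurrent if every finite block (of consecutive letters) occurring in it occurs infinitely often. For a sequence $\mathcal{D}=(d_k)_{k\ge1}$ of integers $\ge2$ set $e_0=1$ and $e_n=\prod_{1\le k\le n}d_k$ for $n\ge1$; for a positive integer $q$ set $w_{\mathcal{D}}(q)=\sup\{n\ge0: q\in e_n\mathbf{Z}\}$ and $|q|_{\mathcal{D}}=1/e_{w_{\mathcal{D}}(q)}=\inf\{1/e_n: q\in e_n\mathbf{Z}\}$. -}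

module Defs where

open import Data.Fin.Base using (Fin; toℕ)
open import Data.Integer.Base as ℤ using (ℤ; +_)
import Data.Integer.DivMod as ℤ
import Data.Integer.Properties as ℤ
open import Data.List.Base using (List; length; lookup)
open import Data.Nat.Base as ℕ using (ℕ; zero; suc; s≤s; z≤n)
open import Data.Nat.Divisibility using (_∣_; _∣?_; ∣⇒≤; 1∣_)
import Data.Nat.Properties as ℕ
open import Data.Product.Base using (∃; _×_; _,_; proj₁; proj₂)
open import Data.Rational.Base
open import Data.Rational.Properties
import Data.Rational.Unnormalised.Base as ℚᵘ
import Data.Rational.Unnormalised.Properties as ℚᵘ
open import Data.Rational.Solver using (module +-*-Solver)
open import Data.Sum.Base using (inj₁; inj₂)
open import Function.Base using (_∘_)
open import Relation.Binary.PropositionalEquality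
open import Relation.Nullary using (¬_; yes; no; contradiction)

OccursAt : {A : Set} → List A → (ℕ → A) → ℕ → Set
OccursAt B w j = (t : Fin (length B)) → w (j ℕ.+ toℕ t) ≡ lookup B t

Recurrent : {A : Set} → (ℕ → A) → Set
Recurrent w = ∀ B → (∃ λ i → OccursAt B w i) →
              ∀ N → ∃ λ j → j ℕ.≥ N × OccursAt B w j

-- A sequence (d_k)_{k ≥ 1} is a function with d k standing for d_{k+1}.

e : (ℕ → ℕ) → ℕ → ℕ
e d zero    = 1
e d (suc n) = e d n ℕ.* d n

greatest : (ℕ → ℕ) → ℕ → ℕ → ℕ
greatest d q zero = 0
greatest d q (suc n) with e d (suc n) ∣? q
... | yes _ = suc n
... | no  _ = greatest d q n

-- For q ≥ 1, the supremum of the n with e_n ∣ q: since e_n > n, only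
-- n ≤ q need be searched (see w-divides and w-greatest).  The value at
-- q = 0, where the supremum is infinite, is meaningless.

w : (ℕ → ℕ) → ℕ → ℕ
w d q = greatest d q q

module _ {d : ℕ → ℕ} (d≥2 : ∀ k → d k ℕ.≥ 2) where

  n<e : ∀ n → n ℕ.< e d n
  n<e zero    = s≤s z≤n
  n<e (suc n) = begin
    suc (suc n)      ≤⟨ s≤s (n<e n) ⟩
    suc (e d n)      ≤⟨ ℕ.+-monoˡ-≤ (e d n) (ℕ.≤-trans (s≤s z≤n) (n<e n)) ⟩
    e d n ℕ.+ e d n  ≡⟨ cong (e d n ℕ.+_) (ℕ.+-identityʳ (e d n)) ⟨
    2 ℕ.* e d n      ≡⟨ ℕ.*-comm 2 (e d n) ⟩
    e d n ℕ.* 2      ≤⟨ ℕ.*-monoʳ-≤ (e d n) (d≥2 n) ⟩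
    e d n ℕ.* d n    ∎
    where open ℕ.≤-Reasoning

  e-nonZero : ∀ n → ℕ.NonZero (e d n)
  e-nonZero n = ℕ.>-nonZero (ℕ.≤-trans (s≤s z≤n) (n<e n))

  w-divides : ∀ q → e d (w d q) ∣ q
  w-divides q = go q
    where
    go : ∀ n → e d (greatest d q n) ∣ q
    go zero = 1∣ q
    go (suc n) with e d (suc n) ∣? q
    ... | yes p = p
    ... | no  _ = go n

  w-greatest : ∀ q → q ℕ.≥ 1 → ∀ n → e d n ∣ q → n ℕ.≤ w d q
  w-greatest q q≥1 n eₙ∣q =
    go q (ℕ.<⇒≤ (ℕ.<-≤-trans (n<e n) (∣⇒≤ {{ℕ.>-nonZero q≥1}} eₙ∣q)))
    where
    go : ∀ b → n ℕ.≤ b → n ℕ.≤ greatest d q b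
    go zero n≤0 = n≤0
    go (suc b) n≤1+b with e d (suc b) ∣? q
    ... | yes _ = n≤1+b
    ... | no ∤q with ℕ.m≤n⇒m<n∨m≡n n≤1+b
    ...   | inj₁ (s≤s n≤b) = go b n≤b
    ...   | inj₂ refl      = contradiction eₙ∣q ∤q

∣_∣[_] : (q : ℕ) {d : ℕ → ℕ} → (∀ k → d k ℕ.≥ 2) → ℚ
∣_∣[_] q {d} d≥2 = (+ 1 / e d (w d q)) {{e-nonZero d≥2 (w d q)}}

∣p∣≤ : ∀ {p q} → p ≤ q → - p ≤ q → ∣ p ∣ ≤ q
∣p∣≤ {p} {q} p≤q -p≤q with ∣p∣≡p∨∣p∣≡-p p
... | inj₁ eq = subst (_≤ q) (sym eq) p≤q
... | inj₂ eq = subst (_≤ q) (sym eq) -p≤q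

∣p-q∣≡∣q-p∣ : ∀ p q → ∣ p - q ∣ ≡ ∣ q - p ∣
∣p-q∣≡∣q-p∣ p q = trans (sym (∣-p∣≡∣p∣ (p - q))) (cong ∣_∣ (lemma p q))
  where
  open +-*-Solver
  lemma : ∀ p q → - (p - q) ≡ q - p
  lemma = solve 2 (λ p q → :- (p :- q) := q :- p) refl

p≤q⇒0≤q-p : ∀ {p q} → p ≤ q → 0ℚ ≤ q - p
p≤q⇒0≤q-p {p} {q} p≤q = subst (_≤ q - p) (+-inverseʳ p) (+-monoˡ-≤ (- p) p≤q)

p≤q⇒∣q-p∣ : ∀ {p q} → p ≤ q → ∣ q - p ∣ ≡ q - p
p≤q⇒∣q-p∣ p≤q = 0≤p⇒∣p∣≡p (p≤q⇒0≤q-p p≤q)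

toℚᵘ-/1 : ∀ i → toℚᵘ (i / 1) ℚᵘ.≃ ℚᵘ.mkℚᵘ i 0
toℚᵘ-/1 i = toℚᵘ-fromℚᵘ (ℚᵘ.mkℚᵘ i 0)

/1-mono-≤ : ∀ {i j} → i ℤ.≤ j → i / 1 ≤ j / 1
/1-mono-≤ {i} {j} i≤j = toℚᵘ-cancel-≤ (begin
  toℚᵘ (i / 1)   ≃⟨ toℚᵘ-/1 i ⟩
  ℚᵘ.mkℚᵘ i 0    ≤⟨ ℚᵘ.*≤* (ℤ.*-monoʳ-≤-nonNeg (+ 1) i≤j) ⟩
  ℚᵘ.mkℚᵘ j 0    ≃⟨ toℚᵘ-/1 j ⟨
  toℚᵘ (j / 1)   ∎)
  where open ℚᵘ.≤-Reasoning

/1-neg : ∀ i → (ℤ.- i) / 1 ≡ - (i / 1)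
/1-neg i = toℚᵘ-injective (begin
  toℚᵘ ((ℤ.- i) / 1)      ≈⟨ toℚᵘ-/1 (ℤ.- i) ⟩
  ℚᵘ.- (ℚᵘ.mkℚᵘ i 0)      ≈⟨ ℚᵘ.-‿cong (toℚᵘ-/1 i) ⟨
  ℚᵘ.- (toℚᵘ (i / 1))     ≈⟨ toℚᵘ-homo‿- (i / 1) ⟨
  toℚᵘ (- (i / 1))        ∎)
  where open import Relation.Binary.Reasoning.Setoid ℚᵘ.≃-setoid

⌊p⌋≤p : ∀ p → ⌊ p ⌋ / 1 ≤ p
⌊p⌋≤p p@record{} = toℚᵘ-cancel-≤ (begin
  toℚᵘ (⌊ p ⌋ / 1)   ≃⟨ toℚᵘ-/1 ⌊ p ⌋ ⟩
  ℚᵘ.mkℚᵘ ⌊ p ⌋ 0    ≤⟨ ℚᵘ.*≤* (ℤ.≤-trans (ℤ.[n/d]*d≤n (↥ p) (↧ p))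
                                 (ℤ.≤-reflexive (sym (ℤ.*-identityʳ (↥ p))))) ⟩
  toℚᵘ p             ∎)
  where open ℚᵘ.≤-Reasoning

i≤⌊p⌋ : ∀ i p → i / 1 ≤ p → i ℤ.≤ ⌊ p ⌋
i≤⌊p⌋ i p@record{} i≤p = ℤ.≮⇒≥ λ ⌊p⌋<i →
  ℤ.<⇒≱ n<1+⌊p⌋*d (ℤ.≤-trans (ℤ.*-monoʳ-≤-nonNeg (↧ p) (ℤ.i<j⇒suc[i]≤j ⌊p⌋<i)) i*d≤n)
  where
  i*d≤n : i ℤ.* ↧ p ℤ.≤ ↥ p
  i*d≤n with ℚᵘ.≤-trans (ℚᵘ.≤-reflexive (ℚᵘ.≃-sym (toℚᵘ-/1 i))) (toℚᵘ-mono-≤ i≤p)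
  ... | ℚᵘ.*≤* le = ℤ.≤-trans le (ℤ.≤-reflexive (ℤ.*-identityʳ (↥ p)))
  n<1+⌊p⌋*d : ↥ p ℤ.< ℤ.suc ⌊ p ⌋ ℤ.* ↧ p
  n<1+⌊p⌋*d = subst (λ k → ↥ p ℤ.< ℤ.suc k ℤ.* ↧ p)
    (sym (ℤ.div-pos-is-/ℕ (↥ p) (↧ₙ p))) (ℤ.n<s[n/ℕd]*d (↥ p) (↧ₙ p))

⌈p⌉≡-⌊-p⌋ : ∀ p → ⌈ p ⌉ ≡ ℤ.- ⌊ - p ⌋
⌈p⌉≡-⌊-p⌋ record{} = refl

p≤⌈p⌉ : ∀ p → p ≤ ⌈ p ⌉ / 1
p≤⌈p⌉ p = subst₂ _≤_ (neg-involutive p)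
  (sym (trans (cong (_/ 1) (⌈p⌉≡-⌊-p⌋ p)) (/1-neg ⌊ - p ⌋)))
  (neg-antimono-≤ (⌊p⌋≤p (- p)))
  where
  open +-*-Solver
  neg-involutive : ∀ p → - (- p) ≡ p
  neg-involutive = solve 1 (λ p → :- (:- p) := p) refl

⌈p⌉≤i : ∀ i p → p ≤ i / 1 → ⌈ p ⌉ ℤ.≤ i
⌈p⌉≤i i p p≤i = subst₂ ℤ._≤_ (sym (⌈p⌉≡-⌊-p⌋ p)) (ℤ.neg-involutive i)
  (ℤ.neg-mono-≤ (i≤⌊p⌋ (ℤ.- i) (- p)
    (subst (_≤ - p) (sym (/1-neg i)) (neg-antimono-≤ p≤i))))

½*1/1+k≤1/2+k : ∀ k → ½ * (+ 1 / suc k) ≤ + 1 / suc (suc k)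
½*1/1+k≤1/2+k k = toℚᵘ-cancel-≤ (begin
  toℚᵘ (½ * (+ 1 / suc k))                ≃⟨ toℚᵘ-homo-* ½ (+ 1 / suc k) ⟩
  toℚᵘ ½ ℚᵘ.* toℚᵘ (+ 1 / suc k)          ≃⟨ ℚᵘ.*-congˡ {toℚᵘ ½} (toℚᵘ-fromℚᵘ (ℚᵘ.mkℚᵘ (+ 1) k)) ⟩
  toℚᵘ ½ ℚᵘ.* ℚᵘ.mkℚᵘ (+ 1) k             ≤⟨ ℚᵘ.*≤* (ℤ.+≤+ le) ⟩
  ℚᵘ.mkℚᵘ (+ 1) (suc k)                   ≃⟨ toℚᵘ-fromℚᵘ (ℚᵘ.mkℚᵘ (+ 1) (suc k)) ⟨
  toℚᵘ (+ 1 / suc (suc k))                ∎)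
  where
  open ℚᵘ.≤-Reasoning
  le : suc (suc (k ℕ.+ 0)) ℕ.≤ suc (k ℕ.+ suc (k ℕ.+ 0)) ℕ.+ 0
  le = subst₂ ℕ._≤_ (cong (suc ∘ suc) (sym (ℕ.+-identityʳ k))) (sym (ℕ.+-identityʳ _))
    (s≤s (subst (suc k ℕ.≤_) (sym (ℕ.+-suc k (k ℕ.+ 0))) (s≤s (ℕ.m≤m+n k (k ℕ.+ 0)))))

archimedean : ∀ ε → 0ℚ < ε → ∃ λ k → + 1 / suc k < ε
archimedean ε@(mkℚ (+ zero) d _) (*<* (ℤ.+<+ ()))
archimedean ε@(mkℚ (ℤ.-[1+ n ]) d _) (*<* ())
archimedean ε@(mkℚ (+ suc n) d _) 0<ε = suc d , toℚᵘ-cancel-< (begin-strict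
  toℚᵘ (+ 1 / suc (suc d))   ≃⟨ toℚᵘ-fromℚᵘ (ℚᵘ.mkℚᵘ (+ 1) (suc d)) ⟩
  ℚᵘ.mkℚᵘ (+ 1) (suc d)      <⟨ ℚᵘ.*<* (ℤ.+<+ lt) ⟩
  toℚᵘ ε                     ∎)
  where
  open ℚᵘ.≤-Reasoning
  lt : suc (d ℕ.+ 0) ℕ.< suc (suc d) ℕ.+ n ℕ.* suc (suc d)
  lt = s≤s (s≤s (subst (ℕ._≤ d ℕ.+ n ℕ.* suc (suc d)) (sym (ℕ.+-identityʳ d)) (ℕ.m≤m+n d _)))

‖_‖ℚ : ℚ → ℚ
‖ p ‖ℚ = (p - ⌊ p ⌋ / 1) ⊓ (⌈ p ⌉ / 1 - p)

‖‖ℚ-lowerBound : ∀ p i → ‖ p ‖ℚ ≤ ∣ p - i / 1 ∣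
‖‖ℚ-lowerBound p i with ≤-total (i / 1) p
... | inj₁ i≤p = begin
  ‖ p ‖ℚ            ≤⟨ p⊓q≤p (p - ⌊ p ⌋ / 1) (⌈ p ⌉ / 1 - p) ⟩
  p - ⌊ p ⌋ / 1     ≤⟨ +-monoʳ-≤ p (neg-antimono-≤ (/1-mono-≤ (i≤⌊p⌋ i p i≤p))) ⟩
  p - i / 1         ≡⟨ p≤q⇒∣q-p∣ i≤p ⟨
  ∣ p - i / 1 ∣     ∎
  where open ≤-Reasoning
... | inj₂ p≤i = begin
  ‖ p ‖ℚ            ≤⟨ p⊓q≤q (p - ⌊ p ⌋ / 1) (⌈ p ⌉ / 1 - p) ⟩
  ⌈ p ⌉ / 1 - p     ≤⟨ +-monoˡ-≤ (- p) (/1-mono-≤ (⌈p⌉≤i i p p≤i)) ⟩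
  i / 1 - p         ≡⟨ p≤q⇒∣q-p∣ p≤i ⟨
  ∣ i / 1 - p ∣     ≡⟨ ∣p-q∣≡∣q-p∣ (i / 1) p ⟩
  ∣ p - i / 1 ∣     ∎
  where open ≤-Reasoning

‖‖ℚ-attained : ∀ p → ∃ λ i → ‖ p ‖ℚ ≡ ∣ p - i / 1 ∣
‖‖ℚ-attained p with ⊓-sel (p - ⌊ p ⌋ / 1) (⌈ p ⌉ / 1 - p)
... | inj₁ eq = ⌊ p ⌋ , trans eq (sym (p≤q⇒∣q-p∣ (⌊p⌋≤p p)))
... | inj₂ eq = ⌈ p ⌉ ,
  trans eq (trans (sym (p≤q⇒∣q-p∣ (p≤⌈p⌉ p))) (∣p-q∣≡∣q-p∣ (⌈ p ⌉ / 1) p))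

‖‖ℚ-lipschitz : ∀ p q → ∣ ‖ p ‖ℚ - ‖ q ‖ℚ ∣ ≤ ∣ p - q ∣
‖‖ℚ-lipschitz p q = ∣p∣≤ (half p q)
  (subst₂ _≤_ (flip ‖ p ‖ℚ ‖ q ‖ℚ) (∣p-q∣≡∣q-p∣ q p) (half q p))
  where
  open +-*-Solver
  flip : ∀ x y → y - x ≡ - (x - y)
  flip = solve 2 (λ x y → y :- x := :- (x :- y)) refl
  split : ∀ p q i → p - i ≡ (p - q) + (q - i)
  split = solve 3 (λ p q i → p :- i := (p :- q) :+ (q :- i)) refl
  cancel : ∀ x y → (x + y) - y ≡ x
  cancel = solve 2 (λ x y → (x :+ y) :- y := x) refl
  half : ∀ p q → ‖ p ‖ℚ - ‖ q ‖ℚ ≤ ∣ p - q ∣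
  half p q = let (i , eq) = ‖‖ℚ-attained q in begin
    ‖ p ‖ℚ - ‖ q ‖ℚ                            ≤⟨ +-monoˡ-≤ (- ‖ q ‖ℚ) (‖‖ℚ-lowerBound p i) ⟩
    ∣ p - i / 1 ∣ - ‖ q ‖ℚ                     ≡⟨ cong (λ x → ∣ x ∣ - ‖ q ‖ℚ) (split p q (i / 1)) ⟩
    ∣ (p - q) + (q - i / 1) ∣ - ‖ q ‖ℚ         ≤⟨ +-monoˡ-≤ (- ‖ q ‖ℚ) (∣p+q∣≤∣p∣+∣q∣ (p - q) (q - i / 1)) ⟩
    (∣ p - q ∣ + ∣ q - i / 1 ∣) - ‖ q ‖ℚ       ≡⟨ cong (λ x → (∣ p - q ∣ + x) - ‖ q ‖ℚ) eq ⟨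
    (∣ p - q ∣ + ‖ q ‖ℚ) - ‖ q ‖ℚ              ≡⟨ cancel ∣ p - q ∣ ‖ q ‖ℚ ⟩
    ∣ p - q ∣                                  ∎
    where open ≤-Reasoning

IsCauchy : (ℕ → ℚ) → Set
IsCauchy s = ∀ ε → 0ℚ < ε → ∃ λ N → ∀ m n → m ℕ.≥ N → n ℕ.≥ N → ∣ s m - s n ∣ < ε

record ℝ : Set where
  constructor mkℝ
  field
    seq    : ℕ → ℚ
    cauchy : IsCauchy seq
open ℝ public

-- The order below is that of the quotient by the relation identifying
-- sequences whose difference tends to 0.  Neither relation is the
-- termwise comparison of the sequences for large n.

infix 4 _<ℝ_ _≤ℝ_

_<ℝ_ : ℝ → ℝ → Set
x <ℝ y = ∃ λ ε → 0ℚ < ε × ∃ λ N → ∀ n → n ℕ.≥ N → seq x n + ε ≤ seq y n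

_≤ℝ_ : ℝ → ℝ → Set
x ≤ℝ y = ¬ (y <ℝ x)

fromℚ : ℚ → ℝ
fromℚ p = mkℝ (λ _ → p) λ ε 0<ε → 0 , λ _ _ _ _ →
  subst (_< ε) (sym (cong ∣_∣ (+-inverseʳ p))) 0<ε

0ℝ : ℝ
0ℝ = fromℚ 0ℚ

-- The second clause is the constructive form of "no lower bound exceeds l":
-- every real above l exceeds some value of f.

IsInfimum : {I : Set} → (I → ℝ) → ℝ → Set
IsInfimum f l = (∀ i → l ≤ℝ f i) × (∀ x → l <ℝ x → ∃ λ i → f i <ℝ x)

infixr 7 _•_

_•_ : ℚ → ℝ → ℝ
c • x = mkℝ (λ n → c * seq x n) isCauchy
  where
  C = ∣ c ∣ + 1ℚ
  instance
    C-pos : Positive C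
    C-pos = nonNeg+pos⇒pos ∣ c ∣ {{∣-∣-nonNeg c}} 1ℚ
    C-nonZero : NonZero C
    C-nonZero = pos⇒nonZero C
    1/C-pos : Positive (1/ C)
    1/C-pos = 1/pos⇒pos C
  open +-*-Solver
  factor : ∀ c x y → c * x - c * y ≡ c * (x - y)
  factor = solve 3 (λ c x y → c :* x :- c :* y := c :* (x :- y)) refl
  ∣c∣≤C : ∣ c ∣ ≤ C
  ∣c∣≤C = subst (_≤ C) (+-identityʳ ∣ c ∣) (+-monoʳ-≤ ∣ c ∣ {0ℚ} {1ℚ} (nonNegative⁻¹ 1ℚ))
  isCauchy : IsCauchy (λ n → c * seq x n)
  isCauchy ε 0<ε = N , λ m n m≥N n≥N → begin-strict
    ∣ c * seq x m - c * seq x n ∣  ≡⟨ cong ∣_∣ (factor c (seq x m) (seq x n)) ⟩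
    ∣ c * (seq x m - seq x n) ∣    ≡⟨ ∣p*q∣≡∣p∣*∣q∣ c (seq x m - seq x n) ⟩
    ∣ c ∣ * ∣ seq x m - seq x n ∣  ≤⟨ *-monoʳ-≤-nonNeg _ {{∣-∣-nonNeg (seq x m - seq x n)}} ∣c∣≤C ⟩
    C * ∣ seq x m - seq x n ∣      <⟨ *-monoʳ-<-pos C (close m n m≥N n≥N) ⟩
    C * (1/ C * ε)                 ≡⟨ *-assoc C (1/ C) ε ⟨
    (C * 1/ C) * ε                 ≡⟨ cong (_* ε) (*-inverseʳ C) ⟩
    1ℚ * ε                         ≡⟨ *-identityˡ ε ⟩
    ε                              ∎
    where
    open ≤-Reasoning
    instance
      ε-pos : Positive ε
      ε-pos = positive 0<ε
    approx = cauchy x (1/ C * ε) (positive⁻¹ (1/ C * ε) {{pos*pos⇒pos (1/ C) ε}})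
    N = proj₁ approx
    close = proj₂ approx

-- ‖_‖ℚ is 1-Lipschitz; this is its continuous extension to ℝ.

‖_‖ : ℝ → ℝ
‖ x ‖ = mkℝ (λ n → ‖ seq x n ‖ℚ) λ ε 0<ε →
  let (N , close) = cauchy x ε 0<ε in
  N , λ m n m≥N n≥N → ≤-<-trans (‖‖ℚ-lipschitz (seq x m) (seq x n)) (close m n m≥N n≥N)

-- Here a k stands for the partial quotient a_{k+1}, and convergent a>0 n
-- is [0; a₁, …, aₙ].

Positive-seq : (ℕ → ℕ) → Set
Positive-seq a = ∀ k → a k ℕ.> 0

mutual

  convergent : {a : ℕ → ℕ} → Positive-seq a → ℕ → ℚ
  convergent a>0 zero = 0ℚ
  convergent a>0 (suc n) = (1/ tail a>0 n) {{pos⇒nonZero (tail a>0 n) {{tail-pos a>0 n}}}}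

  -- a₁ + [0; a₂, …, aₙ₊₁]
  tail : {a : ℕ → ℕ} → Positive-seq a → ℕ → ℚ
  tail {a} a>0 n = + a 0 / 1 + convergent (a>0 ∘ suc) n

  convergent-nonNeg : {a : ℕ → ℕ} (a>0 : Positive-seq a) → ∀ n → NonNegative (convergent a>0 n)
  convergent-nonNeg a>0 zero = _
  convergent-nonNeg a>0 (suc n) = pos⇒nonNeg (convergent a>0 (suc n))
    {{1/pos⇒pos (tail a>0 n) {{tail-pos a>0 n}}}}

  tail-pos : {a : ℕ → ℕ} (a>0 : Positive-seq a) → ∀ n → Positive (tail a>0 n)
  tail-pos {a} a>0 n = pos+nonNeg⇒pos (+ a 0 / 1)
    {{normalize-pos (a 0) 1 {{_}} {{ℕ.>-nonZero (a>0 0)}}}}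
    (convergent (a>0 ∘ suc) n) {{convergent-nonNeg (a>0 ∘ suc) n}}

module _ {a : ℕ → ℕ} (a>0 : Positive-seq a) where

  1≤a : 1ℚ ≤ + a 0 / 1
  1≤a = /1-mono-≤ (ℤ.+≤+ (a>0 0))

  0≤convergent : ∀ n → 0ℚ ≤ convergent a>0 n
  0≤convergent n = nonNegative⁻¹ (convergent a>0 n) {{convergent-nonNeg a>0 n}}

  convergent*tail : ∀ n → convergent a>0 (suc n) * tail a>0 n ≡ 1ℚ
  convergent*tail n = *-inverseˡ (tail a>0 n) {{pos⇒nonZero (tail a>0 n) {{tail-pos a>0 n}}}}

1≤tail : {a : ℕ → ℕ} (a>0 : Positive-seq a) → ∀ n → 1ℚ ≤ tail a>0 n
1≤tail a>0 n = +-mono-≤ {1ℚ} {_} {0ℚ} (1≤a a>0) (0≤convergent (a>0 ∘ suc) n)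

convergent≤1 : {a : ℕ → ℕ} (a>0 : Positive-seq a) → ∀ n → convergent a>0 n ≤ 1ℚ
convergent≤1 a>0 zero = nonNegative⁻¹ 1ℚ
convergent≤1 a>0 (suc n) = begin
  c            ≡⟨ *-identityʳ c ⟨
  c * 1ℚ       ≤⟨ *-monoˡ-≤-nonNeg c {{convergent-nonNeg a>0 (suc n)}} (1≤tail a>0 n) ⟩
  c * tail a>0 n  ≡⟨ convergent*tail a>0 n ⟩
  1ℚ           ∎
  where
  open ≤-Reasoning
  c = convergent a>0 (suc n)

-- Since tail ≥ 1, two steps of the continued fraction map contract
-- distances by the factor ½.

module _ {a : ℕ → ℕ} (a>0 : Positive-seq a) where

  private
    b>0 = a>0 ∘ suc
    c>0 = b>0 ∘ suc
    A = + a 0 / 1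

  twoSteps : ℕ → ℚ
  twoSteps n = convergent a>0 (suc (suc n)) * convergent b>0 (suc n)

  twoSteps-nonNeg : ∀ n → NonNegative (twoSteps n)
  twoSteps-nonNeg n = nonNeg*nonNeg⇒nonNeg
    (convergent a>0 (suc (suc n))) {{convergent-nonNeg a>0 (suc (suc n))}}
    (convergent b>0 (suc n)) {{convergent-nonNeg b>0 (suc n)}}

  twoSteps≤½ : ∀ n → twoSteps n ≤ ½
  twoSteps≤½ n = *-cancelʳ-≤-pos (1ℚ + 1ℚ) (begin
    R * U * (1ℚ + 1ℚ)  ≡⟨ expand R U ⟩
    R * (U + U)        ≤⟨ *-monoˡ-≤-nonNeg R {{convergent-nonNeg a>0 (suc (suc n))}}
                            (+-monoˡ-≤ U (≤-trans (convergent≤1 b>0 (suc n)) (1≤a a>0))) ⟩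
    R * (A + U)        ≡⟨ convergent*tail a>0 (suc n) ⟩
    1ℚ                 ∎)
    where
    open ≤-Reasoning
    open +-*-Solver
    R = convergent a>0 (suc (suc n))
    U = convergent b>0 (suc n)
    expand : ∀ R U → R * U * (1ℚ + 1ℚ) ≡ R * (U + U)
    expand = solve 2 (λ R U → R :* U :* (con 1ℚ :+ con 1ℚ) := R :* (U :+ U)) refl

  twoSteps≤1 : ∀ n → twoSteps n ≤ 1ℚ
  twoSteps≤1 n = ≤-trans (twoSteps≤½ n) (*≤* (ℤ.+≤+ (s≤s z≤n)))

  convergent-difference : ∀ m n →
    convergent a>0 (suc (suc m)) - convergent a>0 (suc (suc n)) ≡
    (twoSteps m * twoSteps n) * (convergent c>0 m - convergent c>0 n)
  convergent-difference m n = begin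
    R - S                                      ≡⟨ cong₂ _-_ (*-identityʳ R) (*-identityʳ S) ⟨
    R * 1ℚ - S * 1ℚ                            ≡⟨ cong₂ (λ x y → R * x - S * y)
                                                    (convergent*tail a>0 (suc n)) (convergent*tail a>0 (suc m)) ⟨
    R * (S * (A + V)) - S * (R * (A + U))      ≡⟨ e₁ R S A U V ⟩
    R * S * (V * 1ℚ - U * 1ℚ)                  ≡⟨ cong₂ (λ x y → R * S * (V * x - U * y))
                                                    (convergent*tail b>0 m) (convergent*tail b>0 n) ⟨
    R * S * (V * (U * (B + X)) - U * (V * (B + Y)))  ≡⟨ e₂ R S U V B X Y ⟩
    ((R * U) * (S * V)) * (X - Y)              ∎
    where
    open ≡-Reasoning
    open +-*-Solver
    R = convergent a>0 (suc (suc m))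
    S = convergent a>0 (suc (suc n))
    U = convergent b>0 (suc m)
    V = convergent b>0 (suc n)
    X = convergent c>0 m
    Y = convergent c>0 n
    B = + a 1 / 1
    e₁ : ∀ R S A U V → R * (S * (A + V)) - S * (R * (A + U)) ≡ R * S * (V * 1ℚ - U * 1ℚ)
    e₁ = solve 5 (λ R S A U V → R :* (S :* (A :+ V)) :- S :* (R :* (A :+ U))
                               := R :* S :* (V :* con 1ℚ :- U :* con 1ℚ)) refl
    e₂ : ∀ R S U V B X Y → R * S * (V * (U * (B + X)) - U * (V * (B + Y))) ≡ ((R * U) * (S * V)) * (X - Y)
    e₂ = solve 7 (λ R S U V B X Y → R :* S :* (V :* (U :* (B :+ X)) :- U :* (V :* (B :+ Y)))
                                   := ((R :* U) :* (S :* V)) :* (X :- Y)) refl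

  convergent-contract : ∀ m n →
    ∣ convergent a>0 (suc (suc m)) - convergent a>0 (suc (suc n)) ∣ ≤
    ½ * ∣ convergent c>0 m - convergent c>0 n ∣
  convergent-contract m n = begin
    ∣ convergent a>0 (suc (suc m)) - convergent a>0 (suc (suc n)) ∣
      ≡⟨ cong ∣_∣ (convergent-difference m n) ⟩
    ∣ (twoSteps m * twoSteps n) * (convergent c>0 m - convergent c>0 n) ∣
      ≡⟨ ∣p*q∣≡∣p∣*∣q∣ (twoSteps m * twoSteps n) (convergent c>0 m - convergent c>0 n) ⟩
    ∣ twoSteps m * twoSteps n ∣ * Δ
      ≡⟨ cong (_* Δ) (0≤p⇒∣p∣≡p (nonNegative⁻¹ (twoSteps m * twoSteps n) {{nonNeg*nonNeg⇒nonNeg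
           (twoSteps m) {{twoSteps-nonNeg m}} (twoSteps n) {{twoSteps-nonNeg n}}}})) ⟩
    twoSteps m * twoSteps n * Δ
      ≤⟨ *-monoʳ-≤-nonNeg Δ {{Δ-nonNeg}} (*-monoʳ-≤-nonNeg (twoSteps n) {{twoSteps-nonNeg n}} (twoSteps≤½ m)) ⟩
    ½ * twoSteps n * Δ
      ≤⟨ *-monoʳ-≤-nonNeg Δ {{Δ-nonNeg}} (*-monoˡ-≤-nonNeg ½ (twoSteps≤1 n)) ⟩
    ½ * 1ℚ * Δ
      ≡⟨ cong (_* Δ) (*-identityʳ ½) ⟩
    ½ * Δ ∎
    where
    open ≤-Reasoning
    Δ = ∣ convergent c>0 m - convergent c>0 n ∣
    Δ-nonNeg : NonNegative Δ
    Δ-nonNeg = ∣-∣-nonNeg (convergent c>0 m - convergent c>0 n)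

convergent-close : {a : ℕ → ℕ} (a>0 : Positive-seq a) → ∀ k m n →
                   m ℕ.≥ k ℕ.+ k → n ℕ.≥ k ℕ.+ k →
                   ∣ convergent a>0 m - convergent a>0 n ∣ ≤ + 1 / suc k
convergent-close a>0 zero m n _ _ = ∣p∣≤ (bound m n)
  (subst (_≤ 1ℚ) (flip (convergent a>0 m) (convergent a>0 n)) (bound n m))
  where
  open +-*-Solver
  flip : ∀ x y → y - x ≡ - (x - y)
  flip = solve 2 (λ x y → y :- x := :- (x :- y)) refl
  bound : ∀ m n → convergent a>0 m - convergent a>0 n ≤ 1ℚ
  bound m n = subst (convergent a>0 m - convergent a>0 n ≤_) (+-identityʳ 1ℚ)
    (+-mono-≤ (convergent≤1 a>0 m) (neg-antimono-≤ (0≤convergent a>0 n)))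
convergent-close a>0 (suc k) m n m≥ n≥
  with subst (m ℕ.≥_) (cong suc (ℕ.+-suc k k)) m≥ | subst (n ℕ.≥_) (cong suc (ℕ.+-suc k k)) n≥
... | s≤s (s≤s {n = m′} m′≥) | s≤s (s≤s {n = n′} n′≥) = begin
  ∣ convergent a>0 (suc (suc m′)) - convergent a>0 (suc (suc n′)) ∣
    ≤⟨ convergent-contract a>0 m′ n′ ⟩
  ½ * ∣ convergent c>0 m′ - convergent c>0 n′ ∣
    ≤⟨ *-monoˡ-≤-nonNeg ½ (convergent-close c>0 k m′ n′ m′≥ n′≥) ⟩
  ½ * (+ 1 / suc k)
    ≤⟨ ½*1/1+k≤1/2+k k ⟩
  + 1 / suc (suc k) ∎
  where
  open ≤-Reasoning
  c>0 = a>0 ∘ suc ∘ suc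

continuedFraction : {a : ℕ → ℕ} → Positive-seq a → ℝ
continuedFraction a>0 = mkℝ (convergent a>0) λ ε 0<ε →
  let (k , 1/k<ε) = archimedean ε 0<ε in
  k ℕ.+ k , λ m n m≥ n≥ → ≤-<-trans (convergent-close a>0 k m n m≥ n≥) 1/k<ε

{-# OPTIONS --safe #-}

-- Let p_k/q_k be the convergents of α and N ≥ 1.  By recurrence, the word
-- a_{m+1} a_{m+2} … has prefixes of lengths ℓ₀ < ℓ₁ < … each of which ends
-- with all the previous ones.  By the pigeonhole principle two of the pairs
-- (q_{m+ℓᵢ-1}, q_{m+ℓᵢ}) agree modulo N, and running the recurrence of the q_k
-- backwards through the common block gives some D ≥ 2 with
-- q_{m+D-1} ≡ q_{m-1} and q_{m+D} ≡ q_m modulo N.  Then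
-- q = |q_{m-1} q_{m+D} - q_m q_{m+D-1}| is a non-zero multiple of N, and
-- q ‖qα‖ ≤ q_m (q_{m-1} + q_m), a bound independent of N.  Take N = e_n.

module Submission where

open import Defs
open import Data.Integer.Base using (+_)
open import Data.Nat.Base using (ℕ; _+_; _≥_; _>_)
open import Data.Product.Base using (∃; _,_)
open import Data.Rational.Base using (_/_)

open import Data.Fin.Base as Fin using (Fin; toℕ; fromℕ<; combine)
import Data.Fin.Properties as Fin
open import Data.Integer.Base as ℤ using (ℤ; -[1+_])
import Data.Integer.Divisibility.Signed as ℤ
import Data.Integer.Properties as ℤ
import Data.Integer.Solver as ℤ
open import Data.List.Base using (applyUpTo)
open import Data.List.Properties using (length-applyUpTo; lookup-applyUpTo)
open import Data.Nat.Base as ℕ using (zero; suc; z≤n; s≤s; _*_; _≤_; _<_)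
open import Data.Nat.Coprimality as Coprime using (Coprime)
open import Data.Nat.Divisibility using (_∣_; divides; ∣⇒≤; ∣m+n∣m⇒∣n; ∣n⇒∣m*n)
open import Data.Nat.DivMod using (_%_; m%n<n; m≡m%n+[m/n]*n)
import Data.Nat.Properties as ℕ
import Data.Nat.Solver as ℕ
open import Data.Product.Base using (_×_; proj₁; proj₂)
open import Data.Rational.Base as ℚ using (ℚ; 0ℚ; 1ℚ; ½)
import Data.Rational.Properties as ℚ
import Data.Rational.Solver as ℚ
import Data.Rational.Unnormalised.Base as ℚᵘ
import Data.Rational.Unnormalised.Properties as ℚᵘ
open import Data.Sum.Base using (inj₁; inj₂)
open import Function.Base using (_∘_)
open import Relation.Binary.PropositionalEquality

-- Recurrent words

-- The prefix occurs at position 0, so recurrence brings it back later. The threshold 2 becomes the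
-- bound `D ≥ 2` that `Q-strict` asks for.
prefix-recurs : {A : Set} {v : ℕ → A} → Recurrent v → ∀ ℓ →
                ∃ λ j → j ≥ 2 × (∀ t → t < ℓ → v (j + t) ≡ v t)
prefix-recurs {v = v} rec ℓ with rec B (0 , λ t → sym (lookup-applyUpTo v ℓ t)) 2
  where B = applyUpTo v ℓ
... | j , j≥2 , occ = j , j≥2 , λ t t<ℓ →
  let t<len = subst (t <_) (sym (length-applyUpTo v ℓ)) t<ℓ
      i     = fromℕ< t<len
      i≡t   = Fin.toℕ-fromℕ< t<len
  in subst (λ s → v (j + s) ≡ v s) i≡t (trans (occ i) (lookup-applyUpTo v ℓ i))

-- A border in the sense of combinatorics on words: the prefix of length `k` is also a suffix of the
-- prefix of length `ℓ`, which then has period `D`.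
Border : {A : Set} → (ℕ → A) → ℕ → ℕ → Set
Border v k ℓ = ∃ λ D → D ≥ 2 × ℓ ≡ D + k × (∀ t → t < k → v (D + t) ≡ v t)

border-trans : {A : Set} {v : ℕ → A} {i k ℓ : ℕ} →
               Border v i k → Border v k ℓ → Border v i ℓ
border-trans {v = v} {i} (D , D≥2 , refl , eqD) (E , _ , refl , eqE) =
  E + D , ℕ.≤-trans D≥2 (ℕ.m≤n+m D E) , sym (ℕ.+-assoc E D i) , λ t t<i → begin
    v (E + D + t)    ≡⟨ cong v (ℕ.+-assoc E D t) ⟩
    v (E + (D + t))  ≡⟨ eqE (D + t) (ℕ.+-monoʳ-< D t<i) ⟩
    v (D + t)        ≡⟨ eqD t t<i ⟩
    v t              ∎
  where open ≡-Reasoning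

module _ {A : Set} {v : ℕ → A} (rec : Recurrent v) where

  borderLength : ℕ → ℕ
  borderLength zero    = 0
  borderLength (suc i) = proj₁ (prefix-recurs {v = v} rec (borderLength i)) + borderLength i

  border-suc : ∀ i → Border v (borderLength i) (borderLength (suc i))
  border-suc i = let (j , j≥2 , eq) = prefix-recurs {v = v} rec (borderLength i) in j , j≥2 , refl , eq

  -- Borders compose, with shifts adding up, so consecutive lengths suffice. All pairs are covered
  -- because the pigeonhole principle does not say which two lengths it picks.
  border-chain : ∀ {i j} → i < j → Border v (borderLength i) (borderLength j)
  border-chain {i} {suc j} (s≤s i≤j) with ℕ.m≤n⇒m<n∨m≡n i≤j
  ... | inj₁ i<j  = border-trans (border-chain i<j) (border-suc j)
  ... | inj₂ refl = border-suc j

-- Continuants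

-- Q a k and P a k stand for q_{k-1} and p_{k-1}, starting from
-- q_{-1} = 0, q_0 = 1 and p_{-1} = 1, p_0 = 0.

Q : (ℕ → ℕ) → ℕ → ℕ
Q a zero          = 0
Q a (suc zero)    = 1
Q a (suc (suc k)) = a k * Q a (suc k) + Q a k

P : (ℕ → ℕ) → ℕ → ℕ
P a zero          = 1
P a (suc zero)    = 0
P a (suc (suc k)) = a k * P a (suc k) + P a k

-- The recurrences of `Q` and `P` append a partial quotient at the end, whereas `convergent` unfolds
-- at the front. This identity and `Q-suc` describe the removal of the first partial quotient.
P-suc : ∀ a k → P a (suc k) ≡ Q (a ∘ suc) k
P-suc a zero          = refl
P-suc a (suc zero)    = cong (_+ 1) (ℕ.*-zeroʳ (a 0))
P-suc a (suc (suc k)) = cong₂ (λ x y → a (suc k) * x + y) (P-suc a (suc k)) (P-suc a k)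

Q-suc : ∀ a k → Q a (suc k) ≡ a 0 * Q (a ∘ suc) k + P (a ∘ suc) k
Q-suc a zero          = sym (cong (_+ 1) (ℕ.*-zeroʳ (a 0)))
Q-suc a (suc zero)    = refl
Q-suc a (suc (suc k)) = begin
  a (suc k) * Q a (suc (suc k)) + Q a (suc k)
    ≡⟨ cong₂ (λ x y → a (suc k) * x + y) (Q-suc a (suc k)) (Q-suc a k) ⟩
  a (suc k) * (a 0 * Q′ (suc k) + P′ (suc k)) + (a 0 * Q′ k + P′ k)
    ≡⟨ solve 6 (λ s z q₁ p₁ q₀ p₀ →
         s :* (z :* q₁ :+ p₁) :+ (z :* q₀ :+ p₀) :=
         z :* (s :* q₁ :+ q₀) :+ (s :* p₁ :+ p₀)) refl
         (a (suc k)) (a 0) (Q′ (suc k)) (P′ (suc k)) (Q′ k) (P′ k) ⟩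
  a 0 * Q′ (suc (suc k)) + P′ (suc (suc k)) ∎
  where
  open ≡-Reasoning
  open ℕ.+-*-Solver
  Q′ = Q (a ∘ suc)
  P′ = P (a ∘ suc)

Q-coprime : ∀ a k → Coprime (Q a (suc k)) (Q a k)
Q-coprime a zero    = Coprime.1-coprimeTo 0
Q-coprime a (suc k) (∣Q″ , ∣Q′) =
  Q-coprime a k (∣Q′ , ∣m+n∣m⇒∣n ∣Q″ (∣n⇒∣m*n (a k) ∣Q′))

module _ {a : ℕ → ℕ} (a>0 : Positive-seq a) where

  Q-step : ∀ k → Q a (suc k) + Q a k ≤ Q a (suc (suc k))
  Q-step k = ℕ.+-monoˡ-≤ (Q a k) (ℕ.m≤n*m (Q a (suc k)) (a k) {{ℕ.>-nonZero (a>0 k)}})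

  Q-mono-suc : ∀ k → Q a k ≤ Q a (suc k)
  Q-mono-suc zero    = z≤n
  Q-mono-suc (suc k) = ℕ.≤-trans (ℕ.m≤m+n _ _) (Q-step k)

  Q-mono-+ : ∀ k r → Q a k ≤ Q a (r + k)
  Q-mono-+ k zero    = ℕ.≤-refl
  Q-mono-+ k (suc r) = ℕ.≤-trans (Q-mono-+ k r) (Q-mono-suc (r + k))

  Q>0 : ∀ k → Q a (suc k) > 0
  Q>0 k = subst (λ i → 1 ≤ Q a i) (ℕ.+-comm k 1) (Q-mono-+ 1 k)

  -- A shift by one would not do: `Q a 1` and `Q a 2` coincide when `a 0` is 1. From `Q a 2` on, the
  -- growth is strict.
  Q-strict : ∀ m D → D ≥ 2 → Q a (suc m) < Q a (suc (D + m))
  Q-strict m (suc (suc D)) _ = begin-strict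
    Q a (suc m)                              ≤⟨ Q-mono-+ (suc m) D ⟩
    Q a (D + suc m)                          ≡⟨ cong (Q a) (ℕ.+-suc D m) ⟩
    Q a (suc (D + m))                        ≤⟨ Q-mono-suc (suc (D + m)) ⟩
    Q a (suc (suc (D + m)))                  <⟨ ℕ.m<m+n _ (Q>0 (D + m)) ⟩
    Q a (suc (suc (D + m))) + Q a (suc (D + m)) ≤⟨ Q-step (suc (D + m)) ⟩
    Q a (suc (suc (suc (D + m))))            ∎
    where open ℕ.≤-Reasoning
  Q-strict m (suc zero) (s≤s ())

-- Continuants modulo N

qℤ : (ℕ → ℕ) → ℕ → ℤ
qℤ a k = + Q a k

pℤ : (ℕ → ℕ) → ℕ → ℤ
pℤ a k = + P a k

pos-*-+ : ∀ x y z → + (x * y + z) ≡ + x ℤ.* + y ℤ.+ + z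
pos-*-+ x y z = trans (ℤ.pos-+ (x * y) z) (cong (ℤ._+ + z) (ℤ.pos-* x y))

%≡⇒∣- : ∀ N .{{_ : ℕ.NonZero N}} x y → x % N ≡ y % N → + N ℤ.∣ + x ℤ.- + y
%≡⇒∣- N x y eq = ℤ.divides (+ (x ℕ./ N) ℤ.- + (y ℕ./ N)) (begin
  + x ℤ.- + y
    ≡⟨ cong₂ ℤ._-_ (expand x) (expand y) ⟩
  (+ (x % N) ℤ.+ + (x ℕ./ N) ℤ.* + N) ℤ.- (+ (y % N) ℤ.+ + (y ℕ./ N) ℤ.* + N)
    ≡⟨ cong (λ r → (+ r ℤ.+ + (x ℕ./ N) ℤ.* + N) ℤ.- (+ (y % N) ℤ.+ + (y ℕ./ N) ℤ.* + N)) eq ⟩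
  (+ (y % N) ℤ.+ + (x ℕ./ N) ℤ.* + N) ℤ.- (+ (y % N) ℤ.+ + (y ℕ./ N) ℤ.* + N)
    ≡⟨ solve 4 (λ r s t n → (r :+ s :* n) :- (r :+ t :* n) := (s :- t) :* n) refl
         (+ (y % N)) (+ (x ℕ./ N)) (+ (y ℕ./ N)) (+ N) ⟩
  (+ (x ℕ./ N) ℤ.- + (y ℕ./ N)) ℤ.* + N ∎)
  where
  open ≡-Reasoning
  open ℤ.+-*-Solver
  expand : ∀ z → + z ≡ + (z % N) ℤ.+ + (z ℕ./ N) ℤ.* + N
  expand z = trans (cong +_ (m≡m%n+[m/n]*n z N))
    (trans (ℤ.pos-+ (z % N) _) (cong (λ u → + (z % N) ℤ.+ u) (ℤ.pos-* (z ℕ./ N) N)))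

-- The recurrence has order two, so a pair of consecutive continuants is the state to compare.
SameResidues : ℕ → (ℕ → ℕ) → ℕ → ℕ → Set
SameResidues N a x y =
  + N ℤ.∣ qℤ a x ℤ.- qℤ a y × + N ℤ.∣ qℤ a (suc x) ℤ.- qℤ a (suc y)

-- The oldest term of the recurrence has coefficient 1, so solving for it involves no division and
-- works modulo any `N`.
sameResidues-pred : ∀ {N a x y} → a x ≡ a y →
                    SameResidues N a (suc x) (suc y) → SameResidues N a x y
sameResidues-pred {N} {a} {x} {y} ax≡ay (∣₁ , ∣₂) =
  subst (+ N ℤ.∣_) difference (ℤ.∣m∣n⇒∣m-n ∣₂ (ℤ.∣n⇒∣m*n (+ a y) ∣₁)) , ∣₁
  where
  open ≡-Reasoning
  open ℤ.+-*-Solver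
  x₀ = qℤ a x
  x₁ = qℤ a (suc x)
  y₀ = qℤ a y
  y₁ = qℤ a (suc y)
  difference : (qℤ a (suc (suc x)) ℤ.- qℤ a (suc (suc y))) ℤ.- + a y ℤ.* (x₁ ℤ.- y₁) ≡ x₀ ℤ.- y₀
  difference = begin
    (qℤ a (suc (suc x)) ℤ.- qℤ a (suc (suc y))) ℤ.- + a y ℤ.* (x₁ ℤ.- y₁)
      ≡⟨ cong₂ (λ u v → (u ℤ.- v) ℤ.- + a y ℤ.* (x₁ ℤ.- y₁))
           (trans (pos-*-+ (a x) _ _) (cong (λ z → + z ℤ.* x₁ ℤ.+ x₀) ax≡ay))
           (pos-*-+ (a y) _ _) ⟩
    ((+ a y ℤ.* x₁ ℤ.+ x₀) ℤ.- (+ a y ℤ.* y₁ ℤ.+ y₀)) ℤ.- + a y ℤ.* (x₁ ℤ.- y₁)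
      ≡⟨ solve 5 (λ c x₀ x₁ y₀ y₁ →
           ((c :* x₁ :+ x₀) :- (c :* y₁ :+ y₀)) :- c :* (x₁ :- y₁) := x₀ :- y₀) refl
           (+ a y) x₀ x₁ y₀ y₁ ⟩
    x₀ ℤ.- y₀ ∎

sameResidues-descend : ∀ {N a x y} t → (∀ s → s < t → a (s + x) ≡ a (s + y)) →
                       SameResidues N a (t + x) (t + y) → SameResidues N a x y
sameResidues-descend zero    _  same = same
sameResidues-descend {a = a} (suc t) eq same =
  sameResidues-descend t (λ s s<t → eq s (ℕ.m<n⇒m<1+n s<t))
    (sameResidues-pred {a = a} (eq t ℕ.≤-refl) same)

-- Two prefixes end at equal residue pairs. The shorter one is a suffix of the longer, and running
-- backwards through both copies leads to their starting points `m` and `D + m`.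
recurrent-residues : ∀ a m → Recurrent (λ k → a (m + k)) → ∀ N .{{_ : ℕ.NonZero N}} →
                     ∃ λ D → D ≥ 2 × SameResidues N a (D + m) m
recurrent-residues a m rec N = D , D≥2 , sameResidues-descend {a = a} (ℓ i)
  (λ s s<ℓ → trans (cong a (shuffle s)) (trans (eq s s<ℓ) (cong a (ℕ.+-comm m s))))
  -- As `ℓ j = D + ℓ i`, the index `ℓ j + m` lies `ℓ i` steps beyond `D + m`.
  (subst (λ x → SameResidues N a x (ℓ i + m))
     (trans (cong (_+ m) ℓj≡) (swap D (ℓ i)))
     ( %≡⇒∣- N (Q a (ℓ j + m)) (Q a (ℓ i + m)) (sym (residue-≡ {ℓ i + m} {ℓ j + m} (proj₁ residues)))
     , %≡⇒∣- N (Q a (suc (ℓ j + m))) (Q a (suc (ℓ i + m)))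
         (sym (residue-≡ {suc (ℓ i + m)} {suc (ℓ j + m)} (proj₂ residues)))))
  where
  residue : ℕ → Fin N
  residue k = fromℕ< (m%n<n (Q a k) N)
  residue-≡ : ∀ {k l} → residue k ≡ residue l → Q a k % N ≡ Q a l % N
  residue-≡ {k} {l} r≡ = trans (sym (Fin.toℕ-fromℕ< (m%n<n (Q a k) N)))
    (trans (cong toℕ r≡) (Fin.toℕ-fromℕ< (m%n<n (Q a l) N)))
  ℓ : ℕ → ℕ
  ℓ = borderLength rec
  -- One more prefix length is taken than there are residue pairs.
  pair : Fin (suc (N * N)) → Fin (N * N)
  pair k = combine (residue (ℓ (toℕ k) + m)) (residue (suc (ℓ (toℕ k) + m)))
  collision = Fin.pigeonhole ℕ.≤-refl pair
  i = toℕ (proj₁ collision)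
  j = toℕ (proj₁ (proj₂ collision))
  residues = Fin.combine-injective _ _ _ _ (proj₂ (proj₂ (proj₂ collision)))
  border = border-chain rec (proj₁ (proj₂ (proj₂ collision)))
  D = proj₁ border
  D≥2 = proj₁ (proj₂ border)
  ℓj≡ = proj₁ (proj₂ (proj₂ border))
  eq = proj₂ (proj₂ (proj₂ border))
  open ℕ.+-*-Solver
  swap : ∀ D l → D + l + m ≡ l + (D + m)
  swap D l = solve 3 (λ D l m → D :+ l :+ m := l :+ (D :+ m)) refl D l m
  shuffle : ∀ s → s + (D + m) ≡ m + (D + s)
  shuffle s = solve 3 (λ s D m → s :+ (D :+ m) := m :+ (D :+ s)) refl s D m

-- Approximation by convergents

-- The factor Q a (suc k) is the one in |q_{k-1} α - p_{k-1}| ≤ 1 / q_k.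

determinant-bound : ∀ a k r →
  ℤ.∣ qℤ a k ℤ.* pℤ a (r + k) ℤ.- pℤ a k ℤ.* qℤ a (r + k) ∣ * Q a (suc k) ≤ Q a (r + k)
determinant-bound a k zero = ℕ.≤-trans (ℕ.≤-reflexive (cong (λ z → ℤ.∣ z ∣ * Q a (suc k))
  (solve 2 (λ x y → x :* y :- y :* x := con (+ 0)) refl (qℤ a k) (pℤ a k)))) z≤n
  where open ℤ.+-*-Solver
-- Consecutive convergents have determinant 1 or -1, so the bound is an equality here.
determinant-bound a k (suc zero) =
  ℕ.≤-reflexive (trans (cong (_* Q a (suc k)) (unimodular k)) (ℕ.*-identityˡ _))
  where
  open ℤ.+-*-Solver
  unimodular : ∀ k → ℤ.∣ qℤ a k ℤ.* pℤ a (suc k) ℤ.- pℤ a k ℤ.* qℤ a (suc k) ∣ ≡ 1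
  unimodular zero    = refl
  unimodular (suc k) = trans (cong ℤ.∣_∣ (trans
      (cong₂ (λ u v → qℤ a (suc k) ℤ.* u ℤ.- pℤ a (suc k) ℤ.* v) (pos-*-+ (a k) _ _) (pos-*-+ (a k) _ _))
      (solve 5 (λ c q₁ q₀ p₁ p₀ →
         q₁ :* (c :* p₁ :+ p₀) :- p₁ :* (c :* q₁ :+ q₀) := :- (q₀ :* p₁ :- p₀ :* q₁)) refl
         (+ a k) (qℤ a (suc k)) (qℤ a k) (pℤ a (suc k)) (pℤ a k))))
    (trans (ℤ.∣-i∣≡∣i∣ (qℤ a k ℤ.* pℤ a (suc k) ℤ.- pℤ a k ℤ.* qℤ a (suc k))) (unimodular k))
-- For fixed `k` the determinant obeys the same recurrence as `Q`, so the triangle inequality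
-- carries the bound on from the two previous indices.
determinant-bound a k (suc (suc r)) = begin
  ℤ.∣ δ (suc (suc n)) ∣ * B
    ≡⟨ cong (λ z → ℤ.∣ z ∣ * B) δ-step ⟩
  ℤ.∣ + a n ℤ.* δ (suc n) ℤ.+ δ n ∣ * B
    ≤⟨ ℕ.*-monoˡ-≤ B (ℤ.∣i+j∣≤∣i∣+∣j∣ (+ a n ℤ.* δ (suc n)) (δ n)) ⟩
  (ℤ.∣ + a n ℤ.* δ (suc n) ∣ + ℤ.∣ δ n ∣) * B
    ≡⟨ cong (λ z → (z + ℤ.∣ δ n ∣) * B) (ℤ.abs-* (+ a n) (δ (suc n))) ⟩
  (a n * ℤ.∣ δ (suc n) ∣ + ℤ.∣ δ n ∣) * B
    ≡⟨ NS.solve 4 (λ c x y b → (c NS.:* x NS.:+ y) NS.:* b NS.:= c NS.:* (x NS.:* b) NS.:+ y NS.:* b) refl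
         (a n) ℤ.∣ δ (suc n) ∣ ℤ.∣ δ n ∣ B ⟩
  a n * (ℤ.∣ δ (suc n) ∣ * B) + ℤ.∣ δ n ∣ * B
    ≤⟨ ℕ.+-mono-≤ (ℕ.*-monoʳ-≤ (a n) (determinant-bound a k (suc r))) (determinant-bound a k r) ⟩
  Q a (suc (suc n)) ∎
  where
  open ℕ.≤-Reasoning
  open ℤ.+-*-Solver
  module NS = ℕ.+-*-Solver
  n = r + k
  B = Q a (suc k)
  δ : ℕ → ℤ
  δ i = qℤ a k ℤ.* pℤ a i ℤ.- pℤ a k ℤ.* qℤ a i
  δ-step : δ (suc (suc n)) ≡ + a n ℤ.* δ (suc n) ℤ.+ δ n
  δ-step = trans
    (cong₂ (λ u v → qℤ a k ℤ.* u ℤ.- pℤ a k ℤ.* v) (pos-*-+ (a n) _ _) (pos-*-+ (a n) _ _))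
    (solve 7 (λ c q p q₁ q₀ p₁ p₀ →
       q :* (c :* p₁ :+ p₀) :- p :* (c :* q₁ :+ q₀) :=
       c :* (q :* p₁ :- p :* q₁) :+ (q :* p₀ :- p :* q₀)) refl
       (+ a n) (qℤ a k) (pℤ a k) (qℤ a (suc n)) (qℤ a n) (pℤ a (suc n)) (pℤ a n))

-- Integers inside ℚ and the distance to the nearest integer

ι : ℤ → ℚ
ι i = i / 1

ι-+ : ∀ i j → ι (i ℤ.+ j) ≡ ι i ℚ.+ ι j
ι-+ i j = ℚ.toℚᵘ-injective (begin
  ℚ.toℚᵘ (ι (i ℤ.+ j))                 ≈⟨ toℚᵘ-/1 (i ℤ.+ j) ⟩
  ℚᵘ.mkℚᵘ (i ℤ.+ j) 0                  ≈⟨ ℚᵘ.*≡* (cong (ℤ._* + 1)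
                                            (sym (cong₂ ℤ._+_ (ℤ.*-identityʳ i) (ℤ.*-identityʳ j)))) ⟩
  ℚᵘ.mkℚᵘ i 0 ℚᵘ.+ ℚᵘ.mkℚᵘ j 0         ≈⟨ ℚᵘ.+-cong (toℚᵘ-/1 i) (toℚᵘ-/1 j) ⟨
  ℚ.toℚᵘ (ι i) ℚᵘ.+ ℚ.toℚᵘ (ι j)       ≈⟨ ℚ.toℚᵘ-homo-+ (ι i) (ι j) ⟨
  ℚ.toℚᵘ (ι i ℚ.+ ι j)                 ∎)
  where open import Relation.Binary.Reasoning.Setoid ℚᵘ.≃-setoid

ι-* : ∀ i j → ι (i ℤ.* j) ≡ ι i ℚ.* ι j
ι-* i j = ℚ.toℚᵘ-injective (begin
  ℚ.toℚᵘ (ι (i ℤ.* j))                 ≈⟨ toℚᵘ-/1 (i ℤ.* j) ⟩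
  ℚᵘ.mkℚᵘ i 0 ℚᵘ.* ℚᵘ.mkℚᵘ j 0         ≈⟨ ℚᵘ.*-cong (toℚᵘ-/1 i) (toℚᵘ-/1 j) ⟨
  ℚ.toℚᵘ (ι i) ℚᵘ.* ℚ.toℚᵘ (ι j)       ≈⟨ ℚ.toℚᵘ-homo-* (ι i) (ι j) ⟨
  ℚ.toℚᵘ (ι i ℚ.* ι j)                 ∎)
  where open import Relation.Binary.Reasoning.Setoid ℚᵘ.≃-setoid

ι-- : ∀ i j → ι (i ℤ.- j) ≡ ι i ℚ.- ι j
ι-- i j = trans (ι-+ i (ℤ.- j)) (cong (ι i ℚ.+_) (/1-neg j))

ι-mono : ∀ {m n} → m ≤ n → ι (+ m) ℚ.≤ ι (+ n)
ι-mono m≤n = /1-mono-≤ (ℤ.+≤+ m≤n)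

ι-nonNeg : ∀ n → ℚ.NonNegative (ι (+ n))
ι-nonNeg n = ℚ.normalize-nonNeg n 1

ι-pos : ∀ {n} → n > 0 → ℚ.Positive (ι (+ n))
ι-pos {n} n>0 = ℚ.normalize-pos n 1 {{_}} {{ℕ.>-nonZero n>0}}

ι-∣∣ : ∀ i → ι (+ ℤ.∣ i ∣) ≡ ℚ.∣ ι i ∣
ι-∣∣ (+ n)    = sym (ℚ.0≤p⇒∣p∣≡p (ℚ.nonNegative⁻¹ (ι (+ n)) {{ι-nonNeg n}}))
ι-∣∣ -[1+ n ] = sym (trans (cong ℚ.∣_∣ (/1-neg (+ suc n)))
  (trans (ℚ.∣-p∣≡∣p∣ (ι (+ suc n))) (sym (ι-∣∣ (+ suc n)))))

-- The distance to the nearest integer is even, so for negative `s` the integer `t` is replaced by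
-- its negative. This lets the determinant `minor` be used without knowing its sign.
‖‖ℚ-∣∣-bound : ∀ s t c → ‖ ι (+ ℤ.∣ s ∣) ℚ.* c ‖ℚ ℚ.≤ ℚ.∣ ι s ℚ.* c ℚ.- ι t ∣
‖‖ℚ-∣∣-bound (+ n)    t c = ‖‖ℚ-lowerBound (ι (+ n) ℚ.* c) t
‖‖ℚ-∣∣-bound -[1+ n ] t c = subst (‖ ι (+ suc n) ℚ.* c ‖ℚ ℚ.≤_) (begin
    ℚ.∣ N ℚ.* c ℚ.- ι (ℤ.- t) ∣      ≡⟨ cong (λ z → ℚ.∣ N ℚ.* c ℚ.- z ∣) (/1-neg t) ⟩
    ℚ.∣ N ℚ.* c ℚ.- ℚ.- ι t ∣        ≡⟨ ℚ.∣-p∣≡∣p∣ (N ℚ.* c ℚ.- ℚ.- ι t) ⟨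
    ℚ.∣ ℚ.- (N ℚ.* c ℚ.- ℚ.- ι t) ∣  ≡⟨ cong ℚ.∣_∣ (solve 3 (λ N c t →
                                            :- (N :* c :- :- t) := (:- N) :* c :- t) refl N c (ι t)) ⟩
    ℚ.∣ ℚ.- N ℚ.* c ℚ.- ι t ∣        ≡⟨ cong (λ z → ℚ.∣ z ℚ.* c ℚ.- ι t ∣) (/1-neg (+ suc n)) ⟨
    ℚ.∣ ι -[1+ n ] ℚ.* c ℚ.- ι t ∣   ∎)
  (‖‖ℚ-lowerBound (N ℚ.* c) (ℤ.- t))
  where
  open ≡-Reasoning
  open ℚ.+-*-Solver
  N = ι (+ suc n)

0≤‖‖ℚ : ∀ p → 0ℚ ℚ.≤ ‖ p ‖ℚ
0≤‖‖ℚ p with ‖‖ℚ-attained p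
... | i , eq = subst (0ℚ ℚ.≤_) (sym eq) (ℚ.0≤∣p∣ (p ℚ.- ι i))

-- Convergents as quotients of continuants

-- This is `[0; a₁, …, aₙ] = pₙ / qₙ` with the denominator cleared. The induction shifts the
-- sequence, following the way `convergent` unfolds.
convergent-≡ : ∀ {a} (a>0 : Positive-seq a) n →
               convergent a>0 n ℚ.* ι (qℤ a (suc n)) ≡ ι (pℤ a (suc n))
convergent-≡     a>0 zero    = refl
convergent-≡ {a} a>0 (suc n) = begin
  R ℚ.* ι (qℤ a (suc (suc n)))
    ≡⟨ cong (λ z → R ℚ.* ι (+ z)) (Q-suc a (suc n)) ⟩
  R ℚ.* ι (+ (a 0 * Q′ + P′))
    ≡⟨ cong (λ z → R ℚ.* ι z) (pos-*-+ (a 0) Q′ P′) ⟩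
  R ℚ.* ι (+ a 0 ℤ.* + Q′ ℤ.+ + P′)
    ≡⟨ cong (R ℚ.*_) (trans (ι-+ (+ a 0 ℤ.* + Q′) (+ P′)) (cong (ℚ._+ ι (+ P′)) (ι-* (+ a 0) (+ Q′)))) ⟩
  R ℚ.* (ι (+ a 0) ℚ.* ι (+ Q′) ℚ.+ ι (+ P′))
    ≡⟨ cong (λ z → R ℚ.* (ι (+ a 0) ℚ.* ι (+ Q′) ℚ.+ z)) (convergent-≡ (a>0 ∘ suc) n) ⟨
  R ℚ.* (ι (+ a 0) ℚ.* ι (+ Q′) ℚ.+ U ℚ.* ι (+ Q′))
    ≡⟨ solve 4 (λ R A q U → R :* (A :* q :+ U :* q) := (R :* (A :+ U)) :* q) refl R (ι (+ a 0)) (ι (+ Q′)) U ⟩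
  (R ℚ.* tail a>0 n) ℚ.* ι (+ Q′)
    ≡⟨ cong (ℚ._* ι (+ Q′)) (convergent*tail a>0 n) ⟩
  1ℚ ℚ.* ι (+ Q′)
    ≡⟨ ℚ.*-identityˡ _ ⟩
  ι (+ Q′)
    ≡⟨ cong (ι ∘ +_) (P-suc a (suc n)) ⟨
  ι (pℤ a (suc (suc n))) ∎
  where
  open ≡-Reasoning
  open ℚ.+-*-Solver
  R = convergent a>0 (suc n)
  U = convergent (a>0 ∘ suc) n
  Q′ = Q (a ∘ suc) (suc n)
  P′ = P (a ∘ suc) (suc n)

-- Multiplying by the denominator of the `n`-th convergent turns the error into the determinant of
-- `determinant-bound`. The bound is uniform in `n`, hence applies to the terms of the Cauchy
-- sequence that defines α.
convergent-approximates : ∀ {a} (a>0 : Positive-seq a) k n → k ≤ suc n →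
  ι (qℤ a (suc k)) ℚ.* ℚ.∣ ι (qℤ a k) ℚ.* convergent a>0 n ℚ.- ι (pℤ a k) ∣ ℚ.≤ 1ℚ
convergent-approximates {a} a>0 k n k≤ = ℚ.*-cancelʳ-≤-pos q {{q-pos}} (begin
  ι (qℤ a (suc k)) ℚ.* ℚ.∣ η ∣ ℚ.* q
    ≡⟨ cong (λ z → ι (qℤ a (suc k)) ℚ.* ℚ.∣ η ∣ ℚ.* z)
         (ℚ.0≤p⇒∣p∣≡p (ℚ.nonNegative⁻¹ q {{ι-nonNeg (Q a (suc n))}})) ⟨
  ι (qℤ a (suc k)) ℚ.* ℚ.∣ η ∣ ℚ.* ℚ.∣ q ∣
    ≡⟨ solve 3 (λ x y z → x :* y :* z := (y :* z) :* x) refl (ι (qℤ a (suc k))) ℚ.∣ η ∣ ℚ.∣ q ∣ ⟩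
  (ℚ.∣ η ∣ ℚ.* ℚ.∣ q ∣) ℚ.* ι (qℤ a (suc k))
    ≡⟨ cong (ℚ._* ι (qℤ a (suc k))) (trans (sym (ℚ.∣p*q∣≡∣p∣*∣q∣ η q))
         (trans (cong ℚ.∣_∣ η*q≡δ) (sym (ι-∣∣ δ)))) ⟩
  ι (+ ℤ.∣ δ ∣) ℚ.* ι (qℤ a (suc k))
    ≡⟨ trans (sym (ι-* (+ ℤ.∣ δ ∣) (qℤ a (suc k)))) (cong ι (sym (ℤ.pos-* ℤ.∣ δ ∣ (Q a (suc k))))) ⟩
  ι (+ (ℤ.∣ δ ∣ * Q a (suc k)))
    ≤⟨ ι-mono (subst (λ i → ℤ.∣ qℤ a k ℤ.* pℤ a i ℤ.- pℤ a k ℤ.* qℤ a i ∣ * Q a (suc k) ≤ Q a i)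
         (ℕ.m∸n+n≡m k≤) (determinant-bound a k (suc n ℕ.∸ k))) ⟩
  q
    ≡⟨ ℚ.*-identityˡ q ⟨
  1ℚ ℚ.* q ∎)
  where
  open ℚ.≤-Reasoning
  open ℚ.+-*-Solver
  c = convergent a>0 n
  q = ι (qℤ a (suc n))
  q-pos : ℚ.Positive q
  q-pos = ι-pos (Q>0 a>0 n)
  η = ι (qℤ a k) ℚ.* c ℚ.- ι (pℤ a k)
  δ = qℤ a k ℤ.* pℤ a (suc n) ℤ.- pℤ a k ℤ.* qℤ a (suc n)
  η*q≡δ : η ℚ.* q ≡ ι δ
  η*q≡δ = trans
    (solve 4 (λ x c p q → (x :* c :- p) :* q := x :* (c :* q) :- p :* q) refl (ι (qℤ a k)) c (ι (pℤ a k)) q)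
    (trans (cong (λ z → ι (qℤ a k) ℚ.* z ℚ.- ι (pℤ a k) ℚ.* q) (convergent-≡ a>0 n))
    (sym (trans (ι-- (qℤ a k ℤ.* pℤ a (suc n)) (pℤ a k ℤ.* qℤ a (suc n)))
      (cong₂ ℚ._-_ (ι-* (qℤ a k) (pℤ a (suc n))) (ι-* (pℤ a k) (qℤ a (suc n)))))))

-- The multiple of N

module _ {a : ℕ → ℕ} (a>0 : Positive-seq a) (m D : ℕ) (D≥2 : D ≥ 2) where

  private
    A = Q a m
    B = Q a (suc m)
    k = D + m
    x = Q a (suc k)
    y = Q a k

  minor : ℤ
  minor = + A ℤ.* + x ℤ.- + B ℤ.* + y

  -- Modulo `N` the determinant has two equal rows.
  minor-divisible : ∀ {N} → SameResidues N a k m → N ∣ ℤ.∣ minor ∣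
  minor-divisible {N} (∣y-A , ∣x-B) = ℤ.∣⇒∣ᵤ (subst (+ N ℤ.∣_)
    (solve 4 (λ A B x y → A :* (x :- B) :- B :* (y :- A) := A :* x :- B :* y) refl (+ A) (+ B) (+ x) (+ y))
    (ℤ.∣m∣n⇒∣m-n (ℤ.∣n⇒∣m*n (+ A) ∣x-B) (ℤ.∣n⇒∣m*n (+ B) ∣y-A)))
    where open ℤ.+-*-Solver

  -- If `A * x = B * y`, then `x` divides `B`, being coprime to `y`; but `0 < B < x`.
  minor-nonZero : ℤ.∣ minor ∣ ≥ 1
  minor-nonZero = ℕ.n≢0⇒n>0 λ ∣minor∣≡0 →
    let Ax≡By = ℤ.+-injective (trans (ℤ.pos-* A x)
          (trans (ℤ.i-j≡0⇒i≡j _ _ (ℤ.∣i∣≡0⇒i≡0 ∣minor∣≡0)) (sym (ℤ.pos-* B y))))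
        x∣B = Coprime.coprime-divisor (Q-coprime a k)
          (divides A (trans (ℕ.*-comm y B) (sym Ax≡By)))
    in ℕ.<⇒≱ (Q-strict a>0 m D D≥2) (∣⇒≤ {{ℕ.>-nonZero (Q>0 a>0 m)}} x∣B)

  -- The difference of two naturals is at most the larger one, and `A ≤ B`, `y ≤ x`.
  minor-≤ : ℤ.∣ minor ∣ ≤ B * x
  minor-≤ = begin
    ℤ.∣ minor ∣
      ≡⟨ cong ℤ.∣_∣ (trans (cong₂ ℤ._-_ (sym (ℤ.pos-* A x)) (sym (ℤ.pos-* B y))) (ℤ.m-n≡m⊖n (A * x) (B * y))) ⟩
    ℤ.∣ (A * x) ℤ.⊖ (B * y) ∣
      ≤⟨ ℤ.∣m⊝n∣≤m⊔n (A * x) (B * y) ⟩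
    (A * x) ℕ.⊔ (B * y)
      ≤⟨ ℕ.⊔-lub (ℕ.*-monoˡ-≤ x (Q-mono-suc a>0 m)) (ℕ.*-monoʳ-≤ B (Q-mono-suc a>0 k)) ⟩
    B * x ∎
    where open ℕ.≤-Reasoning

  -- The error of `minor` combines the errors `η₁` and `η₀` with coefficients `A` and `B`. Each is
  -- at most `1 / x`, which cancels the factor `x` in `minor-≤` and leaves a bound free of `D`.
  minor-approximates : ∀ n → k ≤ n →
    ι (+ ℤ.∣ minor ∣) ℚ.* ‖ ι (+ ℤ.∣ minor ∣) ℚ.* convergent a>0 n ‖ℚ ℚ.≤ ι (+ (B * (A + B)))
  minor-approximates n k≤n = begin
    M ℚ.* ‖ M ℚ.* c ‖ℚ
      ≤⟨ ℚ.*-monoˡ-≤-nonNeg M {{ι-nonNeg ℤ.∣ minor ∣}} (‖‖ℚ-∣∣-bound minor T c) ⟩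
    M ℚ.* ℚ.∣ ι minor ℚ.* c ℚ.- ι T ∣
      ≤⟨ ℚ.*-monoʳ-≤-nonNeg _ {{ℚ.∣-∣-nonNeg (ι minor ℚ.* c ℚ.- ι T)}} (ι-mono minor-≤) ⟩
    ι (+ (B * x)) ℚ.* ℚ.∣ ι minor ℚ.* c ℚ.- ι T ∣
      ≡⟨ cong₂ (λ u v → u ℚ.* ℚ.∣ v ∣) (ι-*ℕ B x) split ⟩
    b ℚ.* X ℚ.* ℚ.∣ α ℚ.* η₁ ℚ.- b ℚ.* η₀ ∣
      ≤⟨ ℚ.*-monoˡ-≤-nonNeg (b ℚ.* X) {{bX-nonNeg}} triangle ⟩
    b ℚ.* X ℚ.* (α ℚ.* ℚ.∣ η₁ ∣ ℚ.+ b ℚ.* ℚ.∣ η₀ ∣)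
      ≡⟨ solve 5 (λ b X α u v → b :* X :* (α :* u :+ b :* v) := b :* (α :* (X :* u) :+ b :* (X :* v))) refl
           b X α ℚ.∣ η₁ ∣ ℚ.∣ η₀ ∣ ⟩
    b ℚ.* (α ℚ.* (X ℚ.* ℚ.∣ η₁ ∣) ℚ.+ b ℚ.* (X ℚ.* ℚ.∣ η₀ ∣))
      ≤⟨ ℚ.*-monoˡ-≤-nonNeg b {{ι-nonNeg B}} (ℚ.+-mono-≤
           (ℚ.*-monoˡ-≤-nonNeg α {{ι-nonNeg A}} Xη₁≤1)
           (ℚ.*-monoˡ-≤-nonNeg b {{ι-nonNeg B}} (convergent-approximates a>0 k n (ℕ.m≤n⇒m≤1+n k≤n)))) ⟩
    b ℚ.* (α ℚ.* 1ℚ ℚ.+ b ℚ.* 1ℚ)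
      ≡⟨ cong (b ℚ.*_) (cong₂ ℚ._+_ (ℚ.*-identityʳ α) (ℚ.*-identityʳ b)) ⟩
    b ℚ.* (α ℚ.+ b)
      ≡⟨ trans (ι-*ℕ B (A + B)) (cong (b ℚ.*_) (trans (cong ι (ℤ.pos-+ A B)) (ι-+ (+ A) (+ B)))) ⟨
    ι (+ (B * (A + B))) ∎
    where
    open ℚ.≤-Reasoning
    open ℚ.+-*-Solver
    c = convergent a>0 n
    M = ι (+ ℤ.∣ minor ∣)
    -- The same combination of numerators as `minor` is of denominators.
    T = + A ℤ.* pℤ a (suc k) ℤ.- + B ℤ.* pℤ a k
    α = ι (+ A)
    b = ι (+ B)
    X = ι (+ x)
    η₁ = X ℚ.* c ℚ.- ι (pℤ a (suc k))
    η₀ = ι (+ y) ℚ.* c ℚ.- ι (pℤ a k)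
    ι-*ℕ : ∀ i j → ι (+ (i * j)) ≡ ι (+ i) ℚ.* ι (+ j)
    ι-*ℕ i j = trans (cong ι (ℤ.pos-* i j)) (ι-* (+ i) (+ j))
    bX-nonNeg : ℚ.NonNegative (b ℚ.* X)
    bX-nonNeg = subst ℚ.NonNegative (ι-*ℕ B x) (ι-nonNeg (B * x))
    ι-minor : ∀ i j u v → ι (i ℤ.* u ℤ.- j ℤ.* v) ≡ ι i ℚ.* ι u ℚ.- ι j ℚ.* ι v
    ι-minor i j u v = trans (ι-- (i ℤ.* u) (j ℤ.* v)) (cong₂ ℚ._-_ (ι-* i u) (ι-* j v))
    split : ι minor ℚ.* c ℚ.- ι T ≡ α ℚ.* η₁ ℚ.- b ℚ.* η₀
    split = trans
      (cong₂ (λ u v → u ℚ.* c ℚ.- v) (ι-minor (+ A) (+ B) (+ x) (+ y))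
        (ι-minor (+ A) (+ B) (pℤ a (suc k)) (pℤ a k)))
      (solve 7 (λ α b X Y c p₁ p₀ →
         (α :* X :- b :* Y) :* c :- (α :* p₁ :- b :* p₀) :=
         α :* (X :* c :- p₁) :- b :* (Y :* c :- p₀)) refl
         α b X (ι (+ y)) c (ι (pℤ a (suc k))) (ι (pℤ a k)))
    ∣ι*∣ : ∀ i z → ℚ.∣ ι (+ i) ℚ.* z ∣ ≡ ι (+ i) ℚ.* ℚ.∣ z ∣
    ∣ι*∣ i z = trans (ℚ.∣p*q∣≡∣p∣*∣q∣ (ι (+ i)) z) (cong (ℚ._* ℚ.∣ z ∣) (sym (ι-∣∣ (+ i))))
    triangle : ℚ.∣ α ℚ.* η₁ ℚ.- b ℚ.* η₀ ∣ ℚ.≤ α ℚ.* ℚ.∣ η₁ ∣ ℚ.+ b ℚ.* ℚ.∣ η₀ ∣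
    triangle = begin
      ℚ.∣ α ℚ.* η₁ ℚ.- b ℚ.* η₀ ∣
        ≤⟨ ℚ.∣p+q∣≤∣p∣+∣q∣ (α ℚ.* η₁) (ℚ.- (b ℚ.* η₀)) ⟩
      ℚ.∣ α ℚ.* η₁ ∣ ℚ.+ ℚ.∣ ℚ.- (b ℚ.* η₀) ∣
        ≡⟨ cong₂ ℚ._+_ (∣ι*∣ A η₁) (trans (ℚ.∣-p∣≡∣p∣ (b ℚ.* η₀)) (∣ι*∣ B η₀)) ⟩
      α ℚ.* ℚ.∣ η₁ ∣ ℚ.+ b ℚ.* ℚ.∣ η₀ ∣ ∎
    Xη₁≤1 : X ℚ.* ℚ.∣ η₁ ∣ ℚ.≤ 1ℚ
    -- For `η₁` the approximation bound carries the next denominator, which is at least `x`.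
    Xη₁≤1 = ℚ.≤-trans
      (ℚ.*-monoʳ-≤-nonNeg ℚ.∣ η₁ ∣ {{ℚ.∣-∣-nonNeg η₁}} (ι-mono (Q-mono-suc a>0 (suc k))))
      (convergent-approximates a>0 (suc k) n (s≤s k≤n))

-- The infimum

e-mono : ∀ {d} (d≥2 : ∀ k → d k ≥ 2) {m n} → m ≤ n → e d m ≤ e d n
e-mono {d} d≥2 {m} {n} m≤n = subst (λ i → e d m ≤ e d i) (ℕ.m∸n+n≡m m≤n) (go (n ℕ.∸ m))
  where
  go : ∀ r → e d m ≤ e d (r + m)
  go zero    = ℕ.≤-refl
  go (suc r) = ℕ.≤-trans (go r)
    (ℕ.m≤m*n _ (d (r + m)) {{ℕ.>-nonZero (ℕ.≤-trans (s≤s z≤n) (d≥2 (r + m)))}})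

1/n*n≡1 : ∀ n .{{_ : ℕ.NonZero n}} → (+ 1 / n) ℚ.* ι (+ n) ≡ 1ℚ
1/n*n≡1 (suc n) = ℚ.toℚᵘ-injective (begin
  ℚ.toℚᵘ ((+ 1 / suc n) ℚ.* ι (+ suc n))            ≈⟨ ℚ.toℚᵘ-homo-* (+ 1 / suc n) (ι (+ suc n)) ⟩
  ℚ.toℚᵘ (+ 1 / suc n) ℚᵘ.* ℚ.toℚᵘ (ι (+ suc n))    ≈⟨ ℚᵘ.*-cong (ℚ.toℚᵘ-fromℚᵘ (ℚᵘ.mkℚᵘ (+ 1) n)) (toℚᵘ-/1 (+ suc n)) ⟩
  ℚᵘ.mkℚᵘ (+ 1) n ℚᵘ.* ℚᵘ.mkℚᵘ (+ suc n) 0          ≈⟨ ℚᵘ.*≡* (cong (+_) (solve 1 (λ n →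
                                                         ((con 1 :+ n) :+ con 0) :* con 1 :=
                                                         con 1 :* ((con 1 :+ n) :* con 1)) refl n)) ⟩
  ℚ.toℚᵘ 1ℚ                                         ∎)
  where
  open import Relation.Binary.Reasoning.Setoid ℚᵘ.≃-setoid
  open ℕ.+-*-Solver

∣∣[]-nonNeg : ∀ q {d} (d≥2 : ∀ k → d k ≥ 2) → ℚ.NonNegative ∣ q ∣[ d≥2 ]
∣∣[]-nonNeg q {d} d≥2 = ℚ.normalize-nonNeg 1 (e d (w d q)) {{e-nonZero d≥2 (w d q)}}

-- Divisibility by `e d (C * suc j)` forces the denominator `E` of `∣ q ∣[ d≥2 ]` to be at least
-- that number. The crude growth `n < e d n` then gives `E ≥ C * suc j`, which absorbs the bound `C`
-- on `z`.
scaled-≤ : ∀ q {d} (d≥2 : ∀ k → d k ≥ 2) C j → C > 0 → q ≥ 1 → e d (C * suc j) ∣ q →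
           ∀ z → 0ℚ ℚ.≤ z → z ℚ.≤ ι (+ C) → ∣ q ∣[ d≥2 ] ℚ.* z ℚ.≤ + 1 / suc j
scaled-≤ q {d} d≥2 C j C>0 q≥1 e∣q z 0≤z z≤C =
  ℚ.*-cancelʳ-≤-pos (ι (+ suc j)) {{ι-pos {suc j} (s≤s z≤n)}} (ℚ.*-cancelʳ-≤-pos (ι (+ C)) {{ι-pos C>0}} (begin
    v ℚ.* z ℚ.* ι (+ suc j) ℚ.* ι (+ C)
      ≡⟨ solve 4 (λ v z s c → v :* z :* s :* c := v :* z :* (c :* s)) refl v z (ι (+ suc j)) (ι (+ C)) ⟩
    v ℚ.* z ℚ.* (ι (+ C) ℚ.* ι (+ suc j))
      ≡⟨ cong (v ℚ.* z ℚ.*_) (trans (cong ι (ℤ.pos-* C (suc j))) (ι-* (+ C) (+ suc j))) ⟨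
    v ℚ.* z ℚ.* ι (+ (C * suc j))
      ≤⟨ ℚ.*-monoˡ-≤-nonNeg (v ℚ.* z) {{vz-nonNeg}} (ι-mono C*sj≤E) ⟩
    v ℚ.* z ℚ.* ι (+ E)
      ≡⟨ solve 3 (λ v z E → v :* z :* E := (v :* E) :* z) refl v z (ι (+ E)) ⟩
    (v ℚ.* ι (+ E)) ℚ.* z
      ≡⟨ cong (ℚ._* z) (1/n*n≡1 E {{E-nonZero}}) ⟩
    1ℚ ℚ.* z
      ≤⟨ ℚ.*-monoˡ-≤-nonNeg 1ℚ z≤C ⟩
    1ℚ ℚ.* ι (+ C)
      ≡⟨ cong (ℚ._* ι (+ C)) (1/n*n≡1 (suc j)) ⟨
    (+ 1 / suc j) ℚ.* ι (+ suc j) ℚ.* ι (+ C) ∎))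
  where
  open ℚ.≤-Reasoning
  open ℚ.+-*-Solver
  v = ∣ q ∣[ d≥2 ]
  E = e d (w d q)
  E-nonZero = e-nonZero d≥2 (w d q)
  vz-nonNeg : ℚ.NonNegative (v ℚ.* z)
  vz-nonNeg = ℚ.nonNeg*nonNeg⇒nonNeg v {{∣∣[]-nonNeg q d≥2}} z {{ℚ.nonNegative 0≤z}}
  C*sj≤E : C * suc j ≤ E
  C*sj≤E = ℕ.≤-trans (ℕ.<⇒≤ (n<e d≥2 (C * suc j))) (e-mono d≥2 (w-greatest d≥2 q q≥1 (C * suc j) e∣q))

half+half : ∀ p → ½ ℚ.* p ℚ.+ ½ ℚ.* p ≡ p
half+half p = trans (sym (ℚ.*-distribʳ-+ p ½ ½)) (ℚ.*-identityˡ p)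

theorem2p3 : (a : ℕ → ℕ) (a>0 : ∀ k → a k > 0) →
    (∃ λ m → Recurrent (λ k → a (m + k))) →
    (d : ℕ → ℕ) (d≥2 : ∀ k → d k ≥ 2) →
    let α = continuedFraction a>0 in
    IsInfimum {I = ∃ λ q → q ≥ 1}
    (λ (q , _) → (+ q / 1) • ∣ q ∣[ d≥2 ] • ‖ (+ q / 1) • α ‖)
    0ℝ
theorem2p3 a a>0 (m , rec) d d≥2 = lowerBound , approached
  where
  open ℚ.≤-Reasoning
  open ℚ.+-*-Solver

  value : ℕ → ℝ
  value q = ι (+ q) • ∣ q ∣[ d≥2 ] • ‖ ι (+ q) • continuedFraction a>0 ‖

  dist : ℕ → ℕ → ℚ
  dist q n = ι (+ q) ℚ.* ‖ ι (+ q) ℚ.* convergent a>0 n ‖ℚ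

  0≤dist : ∀ q n → 0ℚ ℚ.≤ dist q n
  0≤dist q n = subst (ℚ._≤ dist q n) (ℚ.*-zeroʳ (ι (+ q)))
    (ℚ.*-monoˡ-≤-nonNeg (ι (+ q)) {{ι-nonNeg q}} (0≤‖‖ℚ (ι (+ q) ℚ.* convergent a>0 n)))

  value-≡ : ∀ q n → seq (value q) n ≡ ∣ q ∣[ d≥2 ] ℚ.* dist q n
  value-≡ q n = solve 3 (λ q v z → q :* (v :* z) := v :* (q :* z)) refl
    (ι (+ q)) ∣ q ∣[ d≥2 ] ‖ ι (+ q) ℚ.* convergent a>0 n ‖ℚ

  lowerBound : ((q , _) : ∃ λ q → q ≥ 1) → 0ℝ ≤ℝ value q
  -- As `≤ℝ` is a negation, a supposed gap `ε` below 0 is refuted at its own threshold `n`, where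
  -- the term is non-negative.
  lowerBound (q , _) (ε , 0<ε , n , below) = ℚ.<-irrefl refl (begin-strict
    0ℚ                                            <⟨ 0<ε ⟩
    ε                                             ≡⟨ ℚ.+-identityˡ ε ⟨
    0ℚ ℚ.+ ε                                      ≡⟨ cong (ℚ._+ ε) (ℚ.*-zeroʳ ∣ q ∣[ d≥2 ]) ⟨
    ∣ q ∣[ d≥2 ] ℚ.* 0ℚ ℚ.+ ε                     ≤⟨ ℚ.+-monoˡ-≤ ε (ℚ.*-monoˡ-≤-nonNeg ∣ q ∣[ d≥2 ] {{∣∣[]-nonNeg q d≥2}} (0≤dist q n)) ⟩
    ∣ q ∣[ d≥2 ] ℚ.* dist q n ℚ.+ ε               ≡⟨ cong (ℚ._+ ε) (value-≡ q n) ⟨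
    seq (value q) n ℚ.+ ε                         ≤⟨ below n ℕ.≤-refl ⟩
    0ℚ                                            ∎)

  approached : ∀ x → 0ℝ <ℝ x → ∃ λ ((q , _) : ∃ λ q → q ≥ 1) → value q <ℝ x
  approached x (ε , 0<ε , n₀ , above) =
    -- Half of `ε` bounds the value and half remains as the gap required by `<ℝ`. Beyond `k` the
    -- approximation bound holds, beyond `n₀` the lower bound on `x`.
    (q , q≥1) , ½ε , 0<½ε , k + n₀ , λ n n≥ → begin
      seq (value q) n ℚ.+ ½ε
        ≡⟨ cong (ℚ._+ ½ε) (value-≡ q n) ⟩
      ∣ q ∣[ d≥2 ] ℚ.* dist q n ℚ.+ ½ε
        ≤⟨ ℚ.+-monoˡ-≤ ½ε (scaled-≤ q d≥2 C j C>0 q≥1 e∣q (dist q n) (0≤dist q n)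
             (minor-approximates a>0 m D D≥2 n (ℕ.≤-trans (ℕ.m≤m+n k n₀) n≥))) ⟩
      + 1 / suc j ℚ.+ ½ε
        ≤⟨ ℚ.+-monoˡ-≤ ½ε (ℚ.<⇒≤ (proj₂ small)) ⟩
      ½ε ℚ.+ ½ε
        ≡⟨ half+half ε ⟩
      ε
        ≡⟨ ℚ.+-identityˡ ε ⟨
      0ℚ ℚ.+ ε
        ≤⟨ above n (ℕ.≤-trans (ℕ.m≤n+m n₀ k) n≥) ⟩
      seq x n ∎
    where
    ½ε = ½ ℚ.* ε
    0<½ε : 0ℚ ℚ.< ½ε
    0<½ε = ℚ.positive⁻¹ ½ε {{ℚ.pos*pos⇒pos ½ ε {{ℚ.positive 0<ε}}}}
    small = archimedean ½ε 0<½ε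
    j = proj₁ small
    B = Q a (suc m)
    -- The bound of `minor-approximates` depends on `m` only, so it can be fixed before the modulus
    -- `e d (C * suc j)` is chosen and `D` is obtained.
    C = B * (Q a m + B)
    C>0 : C > 0
    C>0 = ℕ.*-mono-≤ {1} {B} {1} {Q a m + B} (Q>0 a>0 m) (ℕ.≤-trans (Q>0 a>0 m) (ℕ.m≤n+m B (Q a m)))
    return = recurrent-residues a m rec (e d (C * suc j)) {{e-nonZero d≥2 (C * suc j)}}
    D = proj₁ return
    D≥2 = proj₁ (proj₂ return)
    k = D + m
    q = ℤ.∣ minor a>0 m D D≥2 ∣
    q≥1 = minor-nonZero a>0 m D D≥2
    e∣q = minor-divisible a>0 m D D≥2 (proj₂ (proj₂ return))
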